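{- For all rational numbers $n_1,p,q$, define $$\begin{aligned} x_1&=(2p^2+6q^2)n_1^2-(p^2+6pq-3q^2)n_1-p^2-3q^2,\\ x_2&=2(p+q)(p-3q)n_1^2-(3p^2+9q^2)n_1+(p+q)(p-3q),\\ x_3&=8pqn_1^2+(p^2+3q^2)n_1-(p+3q)(p-q),\\ y_1&=(2p^2+6q^2)n_1^2-3(p+q)(p-3q)n_1+p^2+3q^2,\\ y_2&=8pqn_1^2-(p^2+3q^2)n_1+(p+q)(p-3q),\\ y_3&=2(p+q)(p-3q)n_1^2-(p^2+3q^2)n_1-(p+3q)(p-q), \end{aligned}$$ and $x_4=-x_3$, $x_5=-x_2$, $x_6=-x_1$, $y_4=-y_3$, $y_5=-y_2$, $y_6=-y_1$. Then $$\sum_{i=1}^6x_i^r=\sum_{i=1}^6y_i^r\qquad\text{for } r=1,2,3,4,5.$$ Moreover, as a parametric solution this is nontrivial: in $\mathbb{Q}[n_1,p,q]$ the multisets $\{x_1,\dots,x_6\}$ and $\{y_1,\dots,y_6\}$ are distinct.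
   Context: An ideal solution of the Tarry-Escott problem of degree $k$ consists of two distinct multisets $\{x_1,\dots,x_{k+1}\}$, $\{y_1,\dots,y_{k+1}\}$ with $\sum x_i^r=\sum y_i^r$ for $r=1,\dots,k$. -}

module Defs where

open import Algebra.Bundles using (CommutativeRing; Semiring)
open import Data.List.Base using (List; []; _∷_; map)
open import Data.Nat.Base using (ℕ; zero; suc)
open import Data.Product.Base using (_,_)
open import Data.Rational.Properties using (+-*-commutativeRing)
open import Data.Vec.Functional as Vector using (Vector)
open import Level using (0ℓ; _⊔_)
import Relation.Binary.Reasoning.Setoid as SetoidReasoning

-- Univariate polynomials over a commutative ring, as lists of coefficients
-- with the constant term first.  Lists may end in zeros, so equality is
-- equality of all coefficients rather than of lists.

module Polynomial {c ℓ} (R : CommutativeRing c ℓ) where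

  open CommutativeRing R hiding (zero)
  open import Algebra.Properties.Ring ring using (-0#≈0#)
  open import Algebra.Properties.CommutativeSemigroup +-commutativeSemigroup
    using (interchange; x∙yz≈y∙xz)

  Poly : Set c
  Poly = List Carrier

  coeff : Poly → ℕ → Carrier
  coeff []       _       = 0#
  coeff (a ∷ _)  zero    = a
  coeff (_ ∷ as) (suc i) = coeff as i

  infix 4 _≈ₚ_
  _≈ₚ_ : Poly → Poly → Set ℓ
  f ≈ₚ g = ∀ i → coeff f i ≈ coeff g i

  infixl 6 _+ₚ_
  _+ₚ_ : Poly → Poly → Poly
  []       +ₚ g        = g
  (a ∷ f)  +ₚ []       = a ∷ f
  (a ∷ f)  +ₚ (b ∷ g)  = a + b ∷ f +ₚ g

  -ₚ_ : Poly → Poly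
  -ₚ_ = map (-_)

  scale : Carrier → Poly → Poly
  scale a = map (a *_)

  infixl 7 _*ₚ_
  _*ₚ_ : Poly → Poly → Poly
  []      *ₚ g = []
  (a ∷ f) *ₚ g = scale a g +ₚ (0# ∷ f *ₚ g)

  const : Carrier → Poly
  const a = a ∷ []

  0ₚ 1ₚ X : Poly
  0ₚ = []
  1ₚ = const 1#
  X  = 0# ∷ 1# ∷ []

  private
    coeff-+ : ∀ f g i → coeff (f +ₚ g) i ≈ coeff f i + coeff g i
    coeff-+ []      g       i       = sym (+-identityˡ _)
    coeff-+ (a ∷ f) []      i       = sym (+-identityʳ _)
    coeff-+ (a ∷ f) (b ∷ g) zero    = refl
    coeff-+ (a ∷ f) (b ∷ g) (suc i) = coeff-+ f g i

    coeff-neg : ∀ f i → coeff (-ₚ f) i ≈ - coeff f i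
    coeff-neg []      i       = sym -0#≈0#
    coeff-neg (a ∷ f) zero    = refl
    coeff-neg (a ∷ f) (suc i) = coeff-neg f i

    coeff-scale : ∀ a f i → coeff (scale a f) i ≈ a * coeff f i
    coeff-scale a []      i       = sym (zeroʳ a)
    coeff-scale a (b ∷ f) zero    = refl
    coeff-scale a (b ∷ f) (suc i) = coeff-scale a f i

    ≈ₚ-refl : ∀ {f} → f ≈ₚ f
    ≈ₚ-refl i = refl

    ≈ₚ-sym : ∀ {f g} → f ≈ₚ g → g ≈ₚ f
    ≈ₚ-sym e i = sym (e i)

    ≈ₚ-trans : ∀ {f g h} → f ≈ₚ g → g ≈ₚ h → f ≈ₚ h
    ≈ₚ-trans d e i = trans (d i) (e i)

    open SetoidReasoning setoid

    +ₚ-cong : ∀ {f f′ g g′} → f ≈ₚ f′ → g ≈ₚ g′ → f +ₚ g ≈ₚ f′ +ₚ g′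
    +ₚ-cong {f} {f′} {g} {g′} d e i = begin
      coeff (f +ₚ g) i         ≈⟨ coeff-+ f g i ⟩
      coeff f i + coeff g i    ≈⟨ +-cong (d i) (e i) ⟩
      coeff f′ i + coeff g′ i  ≈⟨ coeff-+ f′ g′ i ⟨
      coeff (f′ +ₚ g′) i       ∎

    +ₚ-comm : ∀ f g → f +ₚ g ≈ₚ g +ₚ f
    +ₚ-comm f g i = begin
      coeff (f +ₚ g) i       ≈⟨ coeff-+ f g i ⟩
      coeff f i + coeff g i  ≈⟨ +-comm _ _ ⟩
      coeff g i + coeff f i  ≈⟨ coeff-+ g f i ⟨
      coeff (g +ₚ f) i       ∎

    +ₚ-assoc : ∀ f g h → (f +ₚ g) +ₚ h ≈ₚ f +ₚ (g +ₚ h)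
    +ₚ-assoc f g h i = begin
      coeff ((f +ₚ g) +ₚ h) i              ≈⟨ coeff-+ (f +ₚ g) h i ⟩
      coeff (f +ₚ g) i + coeff h i         ≈⟨ +-congʳ (coeff-+ f g i) ⟩
      coeff f i + coeff g i + coeff h i    ≈⟨ +-assoc _ _ _ ⟩
      coeff f i + (coeff g i + coeff h i)  ≈⟨ +-congˡ (coeff-+ g h i) ⟨
      coeff f i + coeff (g +ₚ h) i         ≈⟨ coeff-+ f (g +ₚ h) i ⟨
      coeff (f +ₚ (g +ₚ h)) i              ∎

    +ₚ-identityʳ : ∀ f → f +ₚ 0ₚ ≈ₚ f
    +ₚ-identityʳ f = +ₚ-comm f 0ₚ

    -ₚ-cong : ∀ {f g} → f ≈ₚ g → -ₚ f ≈ₚ -ₚ g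
    -ₚ-cong {f} {g} e i = begin
      coeff (-ₚ f) i  ≈⟨ coeff-neg f i ⟩
      - coeff f i     ≈⟨ -‿cong (e i) ⟩
      - coeff g i     ≈⟨ coeff-neg g i ⟨
      coeff (-ₚ g) i  ∎

    -ₚ-inverseˡ : ∀ f → (-ₚ f) +ₚ f ≈ₚ 0ₚ
    -ₚ-inverseˡ f i = begin
      coeff ((-ₚ f) +ₚ f) i       ≈⟨ coeff-+ (-ₚ f) f i ⟩
      coeff (-ₚ f) i + coeff f i  ≈⟨ +-congʳ (coeff-neg f i) ⟩
      - coeff f i + coeff f i     ≈⟨ -‿inverseˡ _ ⟩
      0#                          ∎

    -ₚ-inverseʳ : ∀ f → f +ₚ (-ₚ f) ≈ₚ 0ₚ
    -ₚ-inverseʳ f = ≈ₚ-trans {f +ₚ (-ₚ f)} {(-ₚ f) +ₚ f} {0ₚ}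
      (+ₚ-comm f (-ₚ f)) (-ₚ-inverseˡ f)

    coeff-*-zero : ∀ a f g → coeff ((a ∷ f) *ₚ g) zero ≈ a * coeff g zero
    coeff-*-zero a f g = begin
      coeff ((a ∷ f) *ₚ g) zero     ≈⟨ coeff-+ (scale a g) _ zero ⟩
      coeff (scale a g) zero + 0#   ≈⟨ +-identityʳ _ ⟩
      coeff (scale a g) zero        ≈⟨ coeff-scale a g zero ⟩
      a * coeff g zero              ∎

    coeff-*-suc : ∀ a f g i →
      coeff ((a ∷ f) *ₚ g) (suc i) ≈ a * coeff g (suc i) + coeff (f *ₚ g) i
    coeff-*-suc a f g i = begin
      coeff ((a ∷ f) *ₚ g) (suc i)                    ≈⟨ coeff-+ (scale a g) _ (suc i) ⟩
      coeff (scale a g) (suc i) + coeff (f *ₚ g) i    ≈⟨ +-congʳ (coeff-scale a g (suc i)) ⟩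
      a * coeff g (suc i) + coeff (f *ₚ g) i          ∎

    *ₚ-congˡ : ∀ f {g h} → g ≈ₚ h → f *ₚ g ≈ₚ f *ₚ h
    *ₚ-congˡ []      e i = refl
    *ₚ-congˡ (a ∷ f) {g} {h} e zero = begin
      coeff ((a ∷ f) *ₚ g) zero  ≈⟨ coeff-*-zero a f g ⟩
      a * coeff g zero           ≈⟨ *-congˡ (e zero) ⟩
      a * coeff h zero           ≈⟨ coeff-*-zero a f h ⟨
      coeff ((a ∷ f) *ₚ h) zero  ∎
    *ₚ-congˡ (a ∷ f) {g} {h} e (suc i) = begin
      coeff ((a ∷ f) *ₚ g) (suc i)            ≈⟨ coeff-*-suc a f g i ⟩
      a * coeff g (suc i) + coeff (f *ₚ g) i  ≈⟨ +-cong (*-congˡ (e (suc i))) (*ₚ-congˡ f e i) ⟩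
      a * coeff h (suc i) + coeff (f *ₚ h) i  ≈⟨ coeff-*-suc a f h i ⟨
      coeff ((a ∷ f) *ₚ h) (suc i)            ∎

    *ₚ-zeroʳ : ∀ f → f *ₚ 0ₚ ≈ₚ 0ₚ
    *ₚ-zeroʳ []      i       = refl
    *ₚ-zeroʳ (a ∷ f) zero    = refl
    *ₚ-zeroʳ (a ∷ f) (suc i) = *ₚ-zeroʳ f i

    coeff-*-zeroʳ : ∀ f b g → coeff (f *ₚ (b ∷ g)) zero ≈ b * coeff f zero
    coeff-*-zeroʳ []      b g = sym (zeroʳ b)
    coeff-*-zeroʳ (a ∷ f) b g = trans (coeff-*-zero a f (b ∷ g)) (*-comm a b)

    coeff-*-sucʳ : ∀ f b g i →
      coeff (f *ₚ (b ∷ g)) (suc i) ≈ b * coeff f (suc i) + coeff (f *ₚ g) i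
    coeff-*-sucʳ []      b g i = sym (trans (+-identityʳ _) (zeroʳ b))
    coeff-*-sucʳ (a ∷ f) b g zero = begin
      coeff ((a ∷ f) *ₚ (b ∷ g)) 1                 ≈⟨ coeff-*-suc a f (b ∷ g) 0 ⟩
      a * coeff g 0 + coeff (f *ₚ (b ∷ g)) 0       ≈⟨ +-cong (sym (coeff-*-zero a f g)) (coeff-*-zeroʳ f b g) ⟩
      coeff ((a ∷ f) *ₚ g) 0 + b * coeff f 0       ≈⟨ +-comm _ _ ⟩
      b * coeff f 0 + coeff ((a ∷ f) *ₚ g) 0       ∎
    coeff-*-sucʳ (a ∷ f) b g (suc i) = begin
      coeff ((a ∷ f) *ₚ (b ∷ g)) (suc (suc i))
        ≈⟨ coeff-*-suc a f (b ∷ g) (suc i) ⟩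
      a * coeff g (suc i) + coeff (f *ₚ (b ∷ g)) (suc i)
        ≈⟨ +-congˡ (coeff-*-sucʳ f b g i) ⟩
      a * coeff g (suc i) + (b * coeff f (suc i) + coeff (f *ₚ g) i)
        ≈⟨ x∙yz≈y∙xz _ _ _ ⟩
      b * coeff f (suc i) + (a * coeff g (suc i) + coeff (f *ₚ g) i)
        ≈⟨ +-congˡ (coeff-*-suc a f g i) ⟨
      b * coeff f (suc i) + coeff ((a ∷ f) *ₚ g) (suc i)
        ∎

    *ₚ-comm : ∀ f g → f *ₚ g ≈ₚ g *ₚ f
    *ₚ-comm []      g i    = sym (*ₚ-zeroʳ g i)
    *ₚ-comm (a ∷ f) g zero = trans (coeff-*-zero a f g) (sym (coeff-*-zeroʳ g a f))
    *ₚ-comm (a ∷ f) g (suc i) = begin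
      coeff ((a ∷ f) *ₚ g) (suc i)            ≈⟨ coeff-*-suc a f g i ⟩
      a * coeff g (suc i) + coeff (f *ₚ g) i  ≈⟨ +-congˡ (*ₚ-comm f g i) ⟩
      a * coeff g (suc i) + coeff (g *ₚ f) i  ≈⟨ coeff-*-sucʳ g a f i ⟨
      coeff (g *ₚ (a ∷ f)) (suc i)            ∎

    *ₚ-congʳ : ∀ h {f g} → f ≈ₚ g → f *ₚ h ≈ₚ g *ₚ h
    *ₚ-congʳ h {f} {g} e i = begin
      coeff (f *ₚ h) i  ≈⟨ *ₚ-comm f h i ⟩
      coeff (h *ₚ f) i  ≈⟨ *ₚ-congˡ h e i ⟩
      coeff (h *ₚ g) i  ≈⟨ *ₚ-comm h g i ⟩
      coeff (g *ₚ h) i  ∎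

    *ₚ-cong : ∀ {f f′ g g′} → f ≈ₚ f′ → g ≈ₚ g′ → f *ₚ g ≈ₚ f′ *ₚ g′
    *ₚ-cong {f} {f′} {g} {g′} d e i = trans (*ₚ-congʳ g {f} {f′} d i) (*ₚ-congˡ f′ e i)

    distribˡₚ : ∀ f g h → f *ₚ (g +ₚ h) ≈ₚ f *ₚ g +ₚ f *ₚ h
    distribˡₚ []      g h i = refl
    distribˡₚ (a ∷ f) g h zero = begin
      coeff ((a ∷ f) *ₚ (g +ₚ h)) 0                    ≈⟨ coeff-*-zero a f (g +ₚ h) ⟩
      a * coeff (g +ₚ h) 0                             ≈⟨ *-congˡ (coeff-+ g h 0) ⟩
      a * (coeff g 0 + coeff h 0)                      ≈⟨ distribˡ _ _ _ ⟩
      a * coeff g 0 + a * coeff h 0                    ≈⟨ +-cong (coeff-*-zero a f g) (coeff-*-zero a f h) ⟨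
      coeff ((a ∷ f) *ₚ g) 0 + coeff ((a ∷ f) *ₚ h) 0  ≈⟨ coeff-+ ((a ∷ f) *ₚ g) _ 0 ⟨
      coeff ((a ∷ f) *ₚ g +ₚ (a ∷ f) *ₚ h) 0           ∎
    distribˡₚ (a ∷ f) g h (suc i) = begin
      coeff ((a ∷ f) *ₚ (g +ₚ h)) (suc i)
        ≈⟨ coeff-*-suc a f (g +ₚ h) i ⟩
      a * coeff (g +ₚ h) (suc i) + coeff (f *ₚ (g +ₚ h)) i
        ≈⟨ +-cong (*-congˡ (coeff-+ g h (suc i))) (distribˡₚ f g h i) ⟩
      a * (coeff g (suc i) + coeff h (suc i)) + coeff (f *ₚ g +ₚ f *ₚ h) i
        ≈⟨ +-cong (distribˡ _ _ _) (coeff-+ (f *ₚ g) _ i) ⟩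
      (a * coeff g (suc i) + a * coeff h (suc i)) + (coeff (f *ₚ g) i + coeff (f *ₚ h) i)
        ≈⟨ interchange _ _ _ _ ⟩
      (a * coeff g (suc i) + coeff (f *ₚ g) i) + (a * coeff h (suc i) + coeff (f *ₚ h) i)
        ≈⟨ +-cong (coeff-*-suc a f g i) (coeff-*-suc a f h i) ⟨
      coeff ((a ∷ f) *ₚ g) (suc i) + coeff ((a ∷ f) *ₚ h) (suc i)
        ≈⟨ coeff-+ ((a ∷ f) *ₚ g) _ (suc i) ⟨
      coeff ((a ∷ f) *ₚ g +ₚ (a ∷ f) *ₚ h) (suc i)
        ∎

    distribʳₚ : ∀ f g h → (g +ₚ h) *ₚ f ≈ₚ g *ₚ f +ₚ h *ₚ f
    distribʳₚ f g h i = begin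
      coeff ((g +ₚ h) *ₚ f) i     ≈⟨ *ₚ-comm (g +ₚ h) f i ⟩
      coeff (f *ₚ (g +ₚ h)) i     ≈⟨ distribˡₚ f g h i ⟩
      coeff (f *ₚ g +ₚ f *ₚ h) i  ≈⟨ +ₚ-cong {f *ₚ g} {g *ₚ f} (*ₚ-comm f g) (*ₚ-comm f h) i ⟩
      coeff (g *ₚ f +ₚ h *ₚ f) i  ∎

    scale-* : ∀ a f g i → coeff (scale a f *ₚ g) i ≈ a * coeff (f *ₚ g) i
    scale-* a []      g i = sym (zeroʳ a)
    scale-* a (b ∷ f) g zero = begin
      coeff (scale a (b ∷ f) *ₚ g) 0  ≈⟨ coeff-*-zero (a * b) (scale a f) g ⟩
      a * b * coeff g 0               ≈⟨ *-assoc _ _ _ ⟩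
      a * (b * coeff g 0)             ≈⟨ *-congˡ (coeff-*-zero b f g) ⟨
      a * coeff ((b ∷ f) *ₚ g) 0      ∎
    scale-* a (b ∷ f) g (suc i) = begin
      coeff (scale a (b ∷ f) *ₚ g) (suc i)                 ≈⟨ coeff-*-suc (a * b) (scale a f) g i ⟩
      a * b * coeff g (suc i) + coeff (scale a f *ₚ g) i   ≈⟨ +-cong (*-assoc _ _ _) (scale-* a f g i) ⟩
      a * (b * coeff g (suc i)) + a * coeff (f *ₚ g) i     ≈⟨ distribˡ _ _ _ ⟨
      a * (b * coeff g (suc i) + coeff (f *ₚ g) i)         ≈⟨ *-congˡ (coeff-*-suc b f g i) ⟨
      a * coeff ((b ∷ f) *ₚ g) (suc i)                     ∎

    *ₚ-assoc : ∀ f g h → (f *ₚ g) *ₚ h ≈ₚ f *ₚ (g *ₚ h)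
    *ₚ-assoc []      g h i = refl
    *ₚ-assoc (a ∷ f) g h i = begin
      coeff ((scale a g +ₚ (0# ∷ f *ₚ g)) *ₚ h) i
        ≈⟨ distribʳₚ h (scale a g) _ i ⟩
      coeff (scale a g *ₚ h +ₚ (0# ∷ f *ₚ g) *ₚ h) i
        ≈⟨ +ₚ-cong {scale a g *ₚ h} {scale a (g *ₚ h)} lemma₁ lemma₂ i ⟩
      coeff (scale a (g *ₚ h) +ₚ (0# ∷ f *ₚ (g *ₚ h))) i
        ∎
      where
      lemma₁ : scale a g *ₚ h ≈ₚ scale a (g *ₚ h)
      lemma₁ j = trans (scale-* a g h j) (sym (coeff-scale a (g *ₚ h) j))

      lemma₂ : (0# ∷ f *ₚ g) *ₚ h ≈ₚ (0# ∷ f *ₚ (g *ₚ h))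
      lemma₂ zero    = trans (coeff-*-zero 0# (f *ₚ g) h) (zeroˡ _)
      lemma₂ (suc j) = begin
        coeff ((0# ∷ f *ₚ g) *ₚ h) (suc j)                ≈⟨ coeff-*-suc 0# (f *ₚ g) h j ⟩
        0# * coeff h (suc j) + coeff ((f *ₚ g) *ₚ h) j    ≈⟨ +-cong (zeroˡ _) (*ₚ-assoc f g h j) ⟩
        0# + coeff (f *ₚ (g *ₚ h)) j                      ≈⟨ +-identityˡ _ ⟩
        coeff (f *ₚ (g *ₚ h)) j                           ∎

    *ₚ-identityˡ : ∀ f → 1ₚ *ₚ f ≈ₚ f
    *ₚ-identityˡ f zero    = trans (coeff-*-zero 1# [] f) (*-identityˡ _)
    *ₚ-identityˡ f (suc i) =
      trans (coeff-*-suc 1# [] f i) (trans (+-identityʳ _) (*-identityˡ _))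

    *ₚ-identityʳ : ∀ f → f *ₚ 1ₚ ≈ₚ f
    *ₚ-identityʳ f i = trans (*ₚ-comm f 1ₚ i) (*ₚ-identityˡ f i)

  polynomialRing : CommutativeRing c ℓ
  polynomialRing = record
    { Carrier = Poly
    ; _≈_     = _≈ₚ_
    ; _+_     = _+ₚ_
    ; _*_     = _*ₚ_
    ; -_      = -ₚ_
    ; 0#      = 0ₚ
    ; 1#      = 1ₚ
    ; isCommutativeRing = record
      { isRing = record
        { +-isAbelianGroup = record
          { isGroup = record
            { isMonoid = record
              { isSemigroup = record
                { isMagma = record
                  { isEquivalence = record
                    { refl  = λ {f} → ≈ₚ-refl {f}
                    ; sym   = λ {f} {g} → ≈ₚ-sym {f} {g}
                    ; trans = λ {f} {g} {h} → ≈ₚ-trans {f} {g} {h}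
                    }
                  ; ∙-cong = λ {f} {f′} {g} {g′} → +ₚ-cong {f} {f′} {g} {g′}
                  }
                ; assoc = +ₚ-assoc
                }
              ; identity = (λ f → ≈ₚ-refl {f}) , +ₚ-identityʳ
              }
            ; inverse = -ₚ-inverseˡ , -ₚ-inverseʳ
            ; ⁻¹-cong = λ {f} {g} → -ₚ-cong {f} {g}
            }
          ; comm = +ₚ-comm
          }
        ; *-cong     = λ {f} {f′} {g} {g′} → *ₚ-cong {f} {f′} {g} {g′}
        ; *-assoc    = *ₚ-assoc
        ; *-identity = *ₚ-identityˡ , *ₚ-identityʳ
        ; distrib    = distribˡₚ , distribʳₚ
        }
      ; *-comm = *ₚ-comm
      }
    }

-- ℚ[n₁,p,q] is built as ((ℚ[n₁])[p])[q].

module ℚ[n₁]     = Polynomial +-*-commutativeRing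
module ℚ[n₁,p]   = Polynomial ℚ[n₁].polynomialRing
module ℚ[n₁,p,q] = Polynomial ℚ[n₁,p].polynomialRing

ℚ-ring : CommutativeRing 0ℓ 0ℓ
ℚ-ring = +-*-commutativeRing

ℚ[n₁,p,q]-ring : CommutativeRing 0ℓ 0ℓ
ℚ[n₁,p,q]-ring = ℚ[n₁,p,q].polynomialRing

Xₙ Xₚ Xq : CommutativeRing.Carrier ℚ[n₁,p,q]-ring
Xₙ = ℚ[n₁,p,q].const (ℚ[n₁,p].const ℚ[n₁].X)
Xₚ = ℚ[n₁,p,q].const ℚ[n₁,p].X
Xq = ℚ[n₁,p,q].X

-- The formulas have integer coefficients, so they are written once over an
-- arbitrary commutative ring; k · a is the k-fold sum a + ⋯ + a.

module Family {c ℓ} (R : CommutativeRing c ℓ) where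

  open CommutativeRing R
  open import Algebra.Definitions.RawSemiring (Semiring.rawSemiring semiring) public
    using (_^_; sum) renaming (_×_ to infixr 8 _·_)
  open import Data.List.Relation.Binary.Permutation.Setoid setoid public
    using (_↭_)

  -- Two families are the same multiset when they agree up to reordering and
  -- the ring's equality.
  SameMultiset : ∀ {m} → Vector Carrier m → Vector Carrier m → Set (c ⊔ ℓ)
  SameMultiset u v = Vector.toList u ↭ Vector.toList v

  module _ (n₁ p q : Carrier) where

    x₁ x₂ x₃ y₁ y₂ y₃ : Carrier
    x₁ = (2 · p ^ 2 + 6 · q ^ 2) * n₁ ^ 2
           - (p ^ 2 + 6 · (p * q) - 3 · q ^ 2) * n₁ - p ^ 2 - 3 · q ^ 2
    x₂ = 2 · ((p + q) * (p - 3 · q)) * n₁ ^ 2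
           - (3 · p ^ 2 + 9 · q ^ 2) * n₁ + (p + q) * (p - 3 · q)
    x₃ = 8 · (p * q) * n₁ ^ 2
           + (p ^ 2 + 3 · q ^ 2) * n₁ - (p + 3 · q) * (p - q)
    y₁ = (2 · p ^ 2 + 6 · q ^ 2) * n₁ ^ 2
           - 3 · ((p + q) * (p - 3 · q)) * n₁ + p ^ 2 + 3 · q ^ 2
    y₂ = 8 · (p * q) * n₁ ^ 2
           - (p ^ 2 + 3 · q ^ 2) * n₁ + (p + q) * (p - 3 · q)
    y₃ = 2 · ((p + q) * (p - 3 · q)) * n₁ ^ 2
           - (p ^ 2 + 3 · q ^ 2) * n₁ - (p + 3 · q) * (p - q)

    x y : Vector Carrier 6
    x = x₁ Vector.∷ x₂ Vector.∷ x₃ Vector.∷ - x₃ Vector.∷ - x₂ Vector.∷ - x₁ Vector.∷ Vector.[]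
    y = y₁ Vector.∷ y₂ Vector.∷ y₃ Vector.∷ - y₃ Vector.∷ - y₂ Vector.∷ - y₁ Vector.∷ Vector.[]

{-# OPTIONS --safe #-}

-- Both families are symmetric under negation, so their odd power sums vanish
-- and their even power sums are twice those of three of their members.  For
-- the exponents 2 and 4 this leaves two identities between polynomials in
-- n₁, p and q.  The parametric solution is nontrivial because x₁ differs from
-- every ± yᵢ in at least one coefficient.

module Submission where

open import Defs
open import Algebra.Bundles using (CommutativeRing)
open import Data.List.Membership.Setoid (CommutativeRing.setoid ℚ[n₁,p,q]-ring) using (_∈_)
open import Data.List.Relation.Binary.Permutation.Setoid.Properties (CommutativeRing.setoid ℚ[n₁,p,q]-ring) using (∈-resp-↭)
open import Data.List.Relation.Unary.Any using (here; there)
open import Data.Nat.Base using (ℕ; _≤_; s≤s)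
open import Data.Product.Base using (_×_; _,_)
open import Data.Rational.Base using (ℚ; 0ℚ; _+_; -_)
open import Data.Rational.Solver using (module +-*-Solver)
open import Data.Vec.Functional as Vector using (Vector)
open import Relation.Binary.PropositionalEquality using (_≡_; refl; sym; trans; cong; module ≡-Reasoning)
open import Relation.Nullary using (¬_)

module _ where

  open Family ℚ-ring
  open +-*-Solver

  -- `x n₁ p q` and `y n₁ p q` unfold to this shape, so facts about it apply to both families
  -- without any rewriting.
  symmetric : (a b c : ℚ) → Vector ℚ 6
  symmetric a b c =
    a Vector.∷ b Vector.∷ c Vector.∷ - c Vector.∷ - b Vector.∷ - a Vector.∷ Vector.[]

  powerSum₃ : (a b c : ℚ) (r : ℕ) → ℚ
  powerSum₃ a b c r = a ^ r + (b ^ r + c ^ r)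

  private
    -- The right nesting and the final `con 0ℚ` mirror how `sum` unfolds on six entries, so the
    -- solver's equation evaluates definitionally to the stated one.
    symmetricPowerSum : ∀ {m} (a b c : Polynomial m) (r : ℕ) → Polynomial m
    symmetricPowerSum a b c r =
      a :^ r :+ (b :^ r :+ (c :^ r :+ ((:- c) :^ r :+ ((:- b) :^ r :+ ((:- a) :^ r :+ con 0ℚ)))))

  symmetric-sum-1 : ∀ a b c → sum (λ i → symmetric a b c i ^ 1) ≡ 0ℚ
  symmetric-sum-1 = solve 3 (λ a b c → symmetricPowerSum a b c 1 := con 0ℚ) refl

  symmetric-sum-3 : ∀ a b c → sum (λ i → symmetric a b c i ^ 3) ≡ 0ℚ
  symmetric-sum-3 = solve 3 (λ a b c → symmetricPowerSum a b c 3 := con 0ℚ) refl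

  symmetric-sum-5 : ∀ a b c → sum (λ i → symmetric a b c i ^ 5) ≡ 0ℚ
  symmetric-sum-5 = solve 3 (λ a b c → symmetricPowerSum a b c 5 := con 0ℚ) refl

  symmetric-sum-2 : ∀ a b c → sum (λ i → symmetric a b c i ^ 2) ≡ 2 · powerSum₃ a b c 2
  symmetric-sum-2 = solve 3 (λ a b c →
    symmetricPowerSum a b c 2 := 2 :× (a :^ 2 :+ (b :^ 2 :+ c :^ 2))) refl

  symmetric-sum-4 : ∀ a b c → sum (λ i → symmetric a b c i ^ 4) ≡ 2 · powerSum₃ a b c 4
  symmetric-sum-4 = solve 3 (λ a b c →
    symmetricPowerSum a b c 4 := 2 :× (a :^ 4 :+ (b :^ 4 :+ c :^ 4))) refl

  private
    module _ {m} (n₁ p q : Polynomial m) where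

      -- Syntactic copies of the formulas in `Family`: the solver normalises expressions, and
      -- evaluating these at `n₁`, `p`, `q` gives back `x₁`, ..., `y₃` definitionally.
      x₁′ x₂′ x₃′ y₁′ y₂′ y₃′ : Polynomial m
      x₁′ = (2 :× p :^ 2 :+ 6 :× q :^ 2) :* n₁ :^ 2
              :- (p :^ 2 :+ 6 :× (p :* q) :- 3 :× q :^ 2) :* n₁ :- p :^ 2 :- 3 :× q :^ 2
      x₂′ = 2 :× ((p :+ q) :* (p :- 3 :× q)) :* n₁ :^ 2
              :- (3 :× p :^ 2 :+ 9 :× q :^ 2) :* n₁ :+ (p :+ q) :* (p :- 3 :× q)
      x₃′ = 8 :× (p :* q) :* n₁ :^ 2
              :+ (p :^ 2 :+ 3 :× q :^ 2) :* n₁ :- (p :+ 3 :× q) :* (p :- q)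
      y₁′ = (2 :× p :^ 2 :+ 6 :× q :^ 2) :* n₁ :^ 2
              :- 3 :× ((p :+ q) :* (p :- 3 :× q)) :* n₁ :+ p :^ 2 :+ 3 :× q :^ 2
      y₂′ = 8 :× (p :* q) :* n₁ :^ 2
              :- (p :^ 2 :+ 3 :× q :^ 2) :* n₁ :+ (p :+ q) :* (p :- 3 :× q)
      y₃′ = 2 :× ((p :+ q) :* (p :- 3 :× q)) :* n₁ :^ 2
              :- (p :^ 2 :+ 3 :× q :^ 2) :* n₁ :- (p :+ 3 :× q) :* (p :- q)

      powerSumEquation : ℕ → Polynomial m × Polynomial m
      powerSumEquation r =
        x₁′ :^ r :+ (x₂′ :^ r :+ x₃′ :^ r) := y₁′ :^ r :+ (y₂′ :^ r :+ y₃′ :^ r)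

  module _ (n₁ p q : ℚ) where

    private
      ∑x₃ ∑y₃ : ℕ → ℚ
      ∑x₃ = powerSum₃ (x₁ n₁ p q) (x₂ n₁ p q) (x₃ n₁ p q)
      ∑y₃ = powerSum₃ (y₁ n₁ p q) (y₂ n₁ p q) (y₃ n₁ p q)

    powerSum₃-2 : ∑x₃ 2 ≡ ∑y₃ 2
    powerSum₃-2 = solve 3 (λ n₁ p q → powerSumEquation n₁ p q 2) refl n₁ p q

    powerSum₃-4 : ∑x₃ 4 ≡ ∑y₃ 4
    powerSum₃-4 = solve 3 (λ n₁ p q → powerSumEquation n₁ p q 4) refl n₁ p q

    powerSums-agree : (r : ℕ) → 1 ≤ r → r ≤ 5 →
      sum (λ i → x n₁ p q i ^ r) ≡ sum (λ i → y n₁ p q i ^ r)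
    powerSums-agree 1 _ _ = trans
      (symmetric-sum-1 (x₁ n₁ p q) (x₂ n₁ p q) (x₃ n₁ p q))
      (sym (symmetric-sum-1 (y₁ n₁ p q) (y₂ n₁ p q) (y₃ n₁ p q)))
    powerSums-agree 2 _ _ = begin
      sum (λ i → x n₁ p q i ^ 2)  ≡⟨ symmetric-sum-2 (x₁ n₁ p q) (x₂ n₁ p q) (x₃ n₁ p q) ⟩
      2 · ∑x₃ 2                   ≡⟨ cong (2 ·_) powerSum₃-2 ⟩
      2 · ∑y₃ 2                   ≡⟨ symmetric-sum-2 (y₁ n₁ p q) (y₂ n₁ p q) (y₃ n₁ p q) ⟨
      sum (λ i → y n₁ p q i ^ 2)  ∎
      where open ≡-Reasoning
    powerSums-agree 3 _ _ = trans
      (symmetric-sum-3 (x₁ n₁ p q) (x₂ n₁ p q) (x₃ n₁ p q))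
      (sym (symmetric-sum-3 (y₁ n₁ p q) (y₂ n₁ p q) (y₃ n₁ p q)))
    powerSums-agree 4 _ _ = begin
      sum (λ i → x n₁ p q i ^ 4)  ≡⟨ symmetric-sum-4 (x₁ n₁ p q) (x₂ n₁ p q) (x₃ n₁ p q) ⟩
      2 · ∑x₃ 4                   ≡⟨ cong (2 ·_) powerSum₃-4 ⟩
      2 · ∑y₃ 4                   ≡⟨ symmetric-sum-4 (y₁ n₁ p q) (y₂ n₁ p q) (y₃ n₁ p q) ⟨
      sum (λ i → y n₁ p q i ^ 4)  ∎
      where open ≡-Reasoning
    powerSums-agree 5 _ _ = trans
      (symmetric-sum-5 (x₁ n₁ p q) (x₂ n₁ p q) (x₃ n₁ p q))
      (sym (symmetric-sum-5 (y₁ n₁ p q) (y₂ n₁ p q) (y₃ n₁ p q)))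
    -- Five peelings of `r + 6 ≤ 5` leave a successor below zero.
    powerSums-agree (ℕ.suc (ℕ.suc (ℕ.suc (ℕ.suc (ℕ.suc (ℕ.suc r)))))) _
      (s≤s (s≤s (s≤s (s≤s (s≤s ())))))

module _ where

  open Family ℚ[n₁,p,q]-ring

  -- e k j i compares the coefficients of n₁ⁱ pʲ qᵏ.
  x₁∉y : ¬ (x₁ Xₙ Xₚ Xq ∈ Vector.toList (y Xₙ Xₚ Xq))
  -- The coefficient of p² is -1 in `x₁`, but 1 in `y₁` and in `y₂`.
  x₁∉y (here e)                                 with () ← e 0 2 0
  x₁∉y (there (here e))                         with () ← e 0 2 0
  -- `y₃` also has -1 at p², so q²n₁² is compared instead: 6 against -6.
  x₁∉y (there (there (here e)))                 with () ← e 2 0 2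
  -- At p²n₁², `x₁` has 2, while the negatives of `y₃`, `y₂`, `y₁` have -2, 0, -2.
  x₁∉y (there (there (there (here e))))         with () ← e 0 2 2
  x₁∉y (there (there (there (there (here e))))) with () ← e 0 2 2
  x₁∉y (there (there (there (there (there (here e)))))) with () ← e 0 2 2

  -- Membership up to the ring's equality survives reordering, so the first entry of `x` would have
  -- to occur in `y`.
  ¬x↭y : ¬ SameMultiset (x Xₙ Xₚ Xq) (y Xₙ Xₚ Xq)
  ¬x↭y x↭y = x₁∉y (∈-resp-↭ {x = x₁ Xₙ Xₚ Xq} x↭y (here λ _ _ _ → refl))

mainTheorem3 : ((n₁ p q : ℚ) (r : ℕ) → 1 ≤ r → r ≤ 5 →
    let open Family ℚ-ring in
    sum (λ i → x n₁ p q i ^ r) ≡ sum (λ i → y n₁ p q i ^ r))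
    × (let open Family ℚ[n₁,p,q]-ring in
    ¬ SameMultiset (x Xₙ Xₚ Xq) (y Xₙ Xₚ Xq))
mainTheorem3 = powerSums-agree , ¬x↭y
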